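{- Let $n$ be a positive integer. The walk matrix $W(A_n)$ of the Dynkin graph $A_n$ has the Smith normal form $$\operatorname{diag}(\underbrace{1,\ldots,1}_{\lceil\frac{n}{2}\rceil},0,\ldots,0),$$ an $n\times n$ diagonal matrix whose first $\lceil n/2\rceil$ diagonal entries are $1$ and whose remaining diagonal entries are $0$.
   Context: The Dynkin graph $A_n$ is the path graph on vertices $1,2,\ldots,n$, with $i$ and $j$ adjacent if and only if $|i-j|=1$. For a simple graph $G$ with $n$ vertices and adjacency matrix $A$, its walk matrix is the $n\times n$ integral matrix $W(G)=[e_n\ \ Ae_n\ \ \cdots\ \ A^{n-1}e_n]$, where $e_n$ is the all-ones column vector of dimension $n$. Smith normal form: for an $n\times n$ integral matrix $M$ of rank $r$, let $D(k)$ be the greatest common divisor of all $k\times k$ minors of $M$ and $D(0):=1$. The invariant factors of $M$ are $d_k=D(k)/D(k-1)$ for $k=1,\ldots,r$, and the Smith normal form of $M$ is the $n\times n$ matrix $\operatorname{diag}(d_1,\ldots,d_r,0,\ldots,0)$. -}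

module Defs where

open import Algebra.Properties.Semiring.Sum using (sum)
open import Data.Bool.Base using (if_then_else_)
open import Data.Fin.Base as Fin using (Fin; zero; suc; toℕ; punchIn)
open import Data.Fin.Properties as Fin using ()
open import Data.Integer.Base as ℤ using (ℤ; +_; 0ℤ; 1ℤ; -1ℤ; ∣_∣)
open import Data.Integer.Properties as ℤ using ()
open import Data.List.Base as List using (List)
open import Data.Nat.Base as ℕ using (ℕ; zero; suc; _≤_; _∸_; ∣_-_∣; NonZero)
open import Data.Nat.GCD using (gcd)
open import Data.Nat.Properties as ℕ using ()
open import Data.Product.Base using (Σ-syntax; ∃-syntax; _×_)
open import Data.Vec.Functional using (Vector; []; _∷_; replicate)
open import Function.Base using (_∘_)
open import Relation.Binary.Core using (Rel)
open import Relation.Binary.Definitions using (Decidable; Symmetric)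
open import Relation.Binary.PropositionalEquality using (_≡_; sym; trans)
open import Relation.Nullary.Decidable.Core using (does)
open import Relation.Nullary.Negation.Core using (¬_)
open import Level using (0ℓ)

------------------------------------------------------------------------
-- Integral matrices

Matrix : ℕ → ℕ → Set
Matrix m n = Fin m → Fin n → ℤ

∑ : ∀ {n} → Vector ℤ n → ℤ
∑ = sum ℤ.+-*-semiring

identity : ∀ {n} → Matrix n n
identity i j = if does (i Fin.≟ j) then 1ℤ else 0ℤ

infixl 7 _⊗_
infixr 8 _⊛_

_⊗_ : ∀ {l m n} → Matrix l m → Matrix m n → Matrix l n
(A ⊗ B) i k = ∑ λ j → A i j ℤ.* B j k

_⊛_ : ∀ {m n} → Matrix m n → Vector ℤ n → Vector ℤ m
(A ⊛ v) i = ∑ λ j → A i j ℤ.* v j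

power : ∀ {n} → Matrix n n → ℕ → Matrix n n
power A zero    = identity
power A (suc k) = A ⊗ power A k

submatrix : ∀ {m n k l} → Matrix m n →
            Vector (Fin m) k → Vector (Fin n) l → Matrix k l
submatrix M rows cols i j = M (rows i) (cols j)

-- Laplace expansion along the first row.
det : ∀ {n} → Matrix n n → ℤ
det {zero}  M = 1ℤ
det {suc n} M = ∑ λ j →
  (-1ℤ ℤ.^ toℕ j) ℤ.* M zero j ℤ.* det (submatrix M suc (punchIn j))

------------------------------------------------------------------------
-- Rank

-- Independence over ℤ; for integral vectors this is the same as
-- independence over ℚ, by clearing denominators.
LinearlyIndependent : ∀ {m k} → Vector (Vector ℤ m) k → Set
LinearlyIndependent {m} {k} v =
  (c : Vector ℤ k) → (∀ i → ∑ (λ j → c j ℤ.* v j i) ≡ 0ℤ) → ∀ j → c j ≡ 0ℤ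

columns : ∀ {m n k} → Matrix m n → Vector (Fin n) k → Vector (Vector ℤ m) k
columns M cols j i = M i (cols j)

-- r is the largest size of a linearly independent family of columns.  (An
-- independent family has no repetitions, so cols need not be injective.)
HasRank : ∀ {m n} → Matrix m n → ℕ → Set
HasRank {m} {n} M r =
  (∃[ cols ] LinearlyIndependent (columns {k = r} M cols)) ×
  (∀ k (cols : Vector (Fin n) k) → LinearlyIndependent (columns M cols) → k ≤ r)

------------------------------------------------------------------------
-- Smith normal form

-- All strictly increasing k-tuples of indices.
selections : ∀ k n → List (Vector (Fin n) k)
selections zero    n       = List.[ [] ]
selections (suc k) zero    = List.[]
selections (suc k) (suc n) =
  List.map (λ s → zero ∷ (suc ∘ s)) (selections k n) List.++
  List.map (suc ∘_) (selections (suc k) n)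

minors : ∀ {m n} → Matrix m n → ℕ → List ℤ
minors {m} {n} M k =
  List.cartesianProductWith (λ rows cols → det (submatrix M rows cols))
                            (selections k m) (selections k n)

-- The gcd of all k × k minors.  The only 0 × 0 minor is 1, so D M 0 is 1.
D : ∀ {m n} → Matrix m n → ℕ → ℕ
D M k = List.foldr gcd 0 (List.map ∣_∣ (minors M k))

-- q = a / b, an exact quotient by a nonzero number.
IsQuotient : (a b q : ℕ) → Set
IsQuotient a b q = NonZero b × (q ℕ.* b ≡ a)

-- The n × n matrix diag(d 1, …, d r, 0, …, 0).
diag : ∀ {n} → (r : ℕ) → (ℕ → ℕ) → Matrix n n
diag r d i j =
  if does (i Fin.≟ j)
  then (if does (suc (toℕ i) ℕ.≤? r) then + d (suc (toℕ i)) else 0ℤ)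
  else 0ℤ

IsSmithNormalForm : ∀ {n} → Matrix n n → Matrix n n → Set
IsSmithNormalForm M S =
  Σ[ r ∈ ℕ ] Σ[ d ∈ (ℕ → ℕ) ]
    HasRank M r ×
    (∀ k → 1 ≤ k → k ≤ r → IsQuotient (D M k) (D M (k ∸ 1)) (d k)) ×
    (∀ i j → S i j ≡ diag r d i j)

------------------------------------------------------------------------
-- Graphs and walk matrices

record SimpleGraph (n : ℕ) : Set₁ where
  field
    Adj         : Rel (Fin n) 0ℓ
    adj?        : Decidable Adj
    symmetric   : Symmetric Adj
    irreflexive : ∀ i → ¬ Adj i i

adjacencyMatrix : ∀ {n} → SimpleGraph n → Matrix n n
adjacencyMatrix G i j = if does (SimpleGraph.adj? G i j) then 1ℤ else 0ℤ

walkMatrix : ∀ {n} → SimpleGraph n → Matrix n n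
walkMatrix {n} G i j = (power (adjacencyMatrix G) (toℕ j) ⊛ replicate n 1ℤ) i

-- The vertices 1, …, n are represented by 0, …, n - 1.
dynkinA : ∀ n → SimpleGraph n
dynkinA n = record
  { Adj         = λ i j → ∣ toℕ i - toℕ j ∣ ≡ 1
  ; adj?        = λ i j → ∣ toℕ i - toℕ j ∣ ℕ.≟ 1
  ; symmetric   = λ {i} {j} e → trans (ℕ.∣-∣-comm (toℕ j) (toℕ i)) e
  ; irreflexive = λ i e → ℕ.0≢1+n (trans (sym (ℕ.∣n-n∣≡0 (toℕ i))) e)
  }

{-# OPTIONS --safe #-}
module Submission where

open import Defs
open import Data.Bool.Base using (if_then_else_)
open import Data.Fin.Base as Fin using (Fin; zero; suc; toℕ; punchIn; inject₁; opposite; fromℕ<)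
import Data.Fin.Permutation as Perm
import Data.Fin.Properties as Fin
open import Data.Integer.Base as ℤ using (ℤ; +_; 0ℤ; 1ℤ; -1ℤ; ∣_∣; _+_; _*_; _-_; -_)
import Data.Integer.Properties as ℤ
open import Data.Integer.Tactic.RingSolver using (solve-∀)
open import Data.List.Base as List using (List)
open import Data.List.Membership.Propositional using (_∈_)
open import Data.List.Membership.Propositional.Properties
  using (∈-++⁺ˡ; ∈-map⁺; ∈-cartesianProductWith⁺)
open import Data.List.Relation.Unary.Any using (here; there)
open import Data.Nat.Base as ℕ using (ℕ; zero; suc; z≤n; s≤s; NonZero; ⌈_/2⌉; _≤_; _<_; _∸_)
open import Data.Nat.Divisibility using (_∣_; ∣-trans; ∣1⇒≡1)
open import Data.Nat.GCD using (gcd; gcd[m,n]∣m; gcd[m,n]∣n)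
import Data.Nat.Properties as ℕ
open import Data.Product.Base using (_,_)
open import Data.Sum.Base using (inj₁; inj₂; [_,_]′)
open import Data.Vec.Functional using (Vector; []; _∷_; replicate; insertAt)
open import Data.Vec.Functional.Properties using (insertAt-lookup; insertAt-punchIn)
open import Function.Base using (_∘_; id)
open import Relation.Binary.PropositionalEquality
open import Relation.Nullary.Decidable using (yes; no; ¬?; decidable-stable; does)
open import Relation.Nullary.Negation using (¬_; contradiction)

import Algebra.Properties.Semiring.Sum ℤ.+-*-semiring as Sum

open ≡-Reasoning

-- Let w k i be the number of walks of length k from vertex i of the path,
-- counted from 0.  As long as no walk can run past an end, w doubles at each
-- step, so for i in the first half w k i = 2 ^ k for k ≤ i, and
-- w (i + 1) i = 2 ^ (i + 1) - 1.  Hence in a leading k × k block with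
-- k ≤ ⌈ n /2⌉ the first two columns are proportional below the first row, and
-- Laplace expansion along that row reduces the determinant to the minor without
-- the second column, which has the same shape.  By induction the block has
-- determinant 1, and the same reduction shows that its columns are independent.
-- Reflecting the path makes row i equal to row n - 1 - i, so the rank is at
-- most ⌈ n /2⌉.

∑-cong : ∀ {n} {f g : Vector ℤ n} → f ≗ g → ∑ f ≡ ∑ g
∑-cong = Sum.sum-cong-≗

∑-zero : ∀ {n} {f : Vector ℤ n} → (∀ i → f i ≡ 0ℤ) → ∑ f ≡ 0ℤ
∑-zero {n} f≡0 = trans (∑-cong f≡0) (Sum.sum-replicate-zero n)

-- Determinants

det-cong : ∀ {n} (M N : Matrix n n) → (∀ i j → M i j ≡ N i j) → det M ≡ det N
det-cong {zero}  M N M≡N = refl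
det-cong {suc n} M N M≡N = ∑-cong λ j →
  cong₂ _*_ (cong ((-1ℤ ℤ.^ toℕ j) *_) (M≡N zero j))
            (det-cong (submatrix M suc (punchIn j)) (submatrix N suc (punchIn j))
                      λ i k → M≡N (suc i) (punchIn j k))

-- In the expansion along the first row, the term of the first column carries the factor in its
-- entry; every other term has a minor whose first column is still scaled, so induction applies.
det-scaleFirstColumn : ∀ {n} c (M N : Matrix (suc n) (suc n)) →
  (∀ i → M i zero ≡ c * N i zero) → (∀ i j → M i (suc j) ≡ N i (suc j)) →
  det M ≡ c * det N
det-scaleFirstColumn {n} c M N M₀≡cN₀ M≡N = begin
  det M
    ≡⟨ ∑-cong term ⟩
  ∑ (λ j → c * ((-1ℤ ℤ.^ toℕ j) * N zero j * det (N′ j)))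
    ≡⟨ Sum.*-distribˡ-sum c (λ j → (-1ℤ ℤ.^ toℕ j) * N zero j * det (N′ j)) ⟨
  c * det N ∎
  where
  M′ N′ : Fin (suc n) → Matrix n n
  M′ j = submatrix M suc (punchIn j)
  N′ j = submatrix N suc (punchIn j)

  scaleEntry : ∀ s c x d → s * (c * x) * d ≡ c * (s * x * d)
  scaleEntry = solve-∀

  scaleMinor : ∀ s c x d → s * x * (c * d) ≡ c * (s * x * d)
  scaleMinor = solve-∀

  term : ∀ j → (-1ℤ ℤ.^ toℕ j) * M zero j * det (M′ j)
             ≡ c * ((-1ℤ ℤ.^ toℕ j) * N zero j * det (N′ j))
  term zero = trans
    (cong₂ (λ x d → 1ℤ * x * d) (M₀≡cN₀ zero)
      (det-cong (M′ zero) (N′ zero) λ i j → M≡N (suc i) j))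
    (scaleEntry 1ℤ c (N zero zero) (det (N′ zero)))
  term j@(suc {suc _} j′) = trans
    (cong₂ (λ x d → (-1ℤ ℤ.^ toℕ j) * x * d) (M≡N zero j′)
      (det-scaleFirstColumn c (M′ j) (N′ j) (λ i → M₀≡cN₀ (suc i)) λ i k → M≡N (suc i) (punchIn j′ k)))
    (scaleMinor (-1ℤ ℤ.^ toℕ j) c (N zero j) (det (N′ j)))

-- The minors along the first row that keep both of the first two columns
-- vanish, and the remaining two are multiples of each other.
det-proportionalColumns : ∀ {n} c (M : Matrix (2 ℕ.+ n) (2 ℕ.+ n)) →
  (∀ i → M (suc i) (suc zero) ≡ c * M (suc i) zero) →
  det M ≡ (c * M zero zero - M zero (suc zero)) * det (submatrix M suc (punchIn (suc zero)))

-- When the first row obeys the relation too, the scalar factor in `det-proportionalColumns` is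
-- zero. The mutual recursion descends on size: the minors in `det-minor≡0` keep both columns and
-- are one smaller.
det-proportionalColumns≡0 : ∀ {n} c (M : Matrix (2 ℕ.+ n) (2 ℕ.+ n)) →
  (∀ i → M i (suc zero) ≡ c * M i zero) → det M ≡ 0ℤ

det-minor≡0 : ∀ {n} c (M : Matrix (2 ℕ.+ n) (2 ℕ.+ n)) →
  (∀ i → M (suc i) (suc zero) ≡ c * M (suc i) zero) →
  ∀ j → det (submatrix M suc (punchIn (suc (suc j)))) ≡ 0ℤ

det-proportionalColumns {n} c M M₁≡cM₀ = begin
  det M
    ≡⟨ cong₂ (λ x y → 1ℤ * M₀₀ * x + (-1ℤ * M₀₁ * d + y))
         -- Omitting the first column instead of the second leaves `c` times the same leading
         -- column, and all later columns agree.
         (det-scaleFirstColumn c (M′ zero) (M′ (suc zero)) M₁≡cM₀ (λ _ _ → refl))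
         (∑-zero vanishing) ⟩
  1ℤ * M₀₀ * (c * d) + (-1ℤ * M₀₁ * d + 0ℤ)
    ≡⟨ cong₂ (λ x y → x * (c * d) + y) (ℤ.*-identityˡ M₀₀)
         (trans (ℤ.+-identityʳ (-1ℤ * M₀₁ * d)) (cong (_* d) (ℤ.-1*i≡-i M₀₁))) ⟩
  M₀₀ * (c * d) + - M₀₁ * d
    ≡⟨ collect c M₀₀ M₀₁ d ⟩
  (c * M₀₀ - M₀₁) * d ∎
  where
  M₀₀ = M zero zero
  M₀₁ = M zero (suc zero)

  M′ : Fin (2 ℕ.+ n) → Matrix (suc n) (suc n)
  M′ j = submatrix M suc (punchIn j)

  d = det (M′ (suc zero))

  collect : ∀ c x y d → x * (c * d) + - y * d ≡ (c * x - y) * d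
  collect = solve-∀

  vanishing : ∀ (j : Fin n) → (-1ℤ ℤ.^ (2 ℕ.+ toℕ j)) * M zero (suc (suc j)) *
                              det (M′ (suc (suc j))) ≡ 0ℤ
  vanishing j = trans (cong (x *_) (det-minor≡0 c M M₁≡cM₀ j)) (ℤ.*-zeroʳ x)
    where x = (-1ℤ ℤ.^ (2 ℕ.+ toℕ j)) * M zero (suc (suc j))

det-minor≡0 {suc n} c M M₁≡cM₀ j =
  det-proportionalColumns≡0 c (submatrix M suc (punchIn (suc (suc j)))) M₁≡cM₀

det-proportionalColumns≡0 c M M₁≡cM₀ = begin
  det M
    ≡⟨ det-proportionalColumns c M (λ i → M₁≡cM₀ (suc i)) ⟩
  (c * M zero zero - M zero (suc zero)) * d
    ≡⟨ cong (_* d) (ℤ.i≡j⇒i-j≡0 (sym (M₁≡cM₀ zero))) ⟩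
  0ℤ * d
    ≡⟨ ℤ.*-zeroˡ d ⟩
  0ℤ ∎
  where d = det (submatrix M suc (punchIn (suc zero)))

-- Column `suc j` is constrained only from row `j` down, starting just above the diagonal. The
-- higher entries stay free: they meet vanishing minors in the determinant and zero coefficients in
-- the independence proof.
record Staircase {n} (a : Vector ℤ n) (M : Matrix (suc n) (suc n)) : Set where
  field
    first : ∀ i → M i zero ≡ 1ℤ
    below : ∀ i j → toℕ j < toℕ i → M i (suc j) ≡ a j
    step  : ∀ j → M (inject₁ j) (suc j) ≡ a j - 1ℤ

open Staircase

module _ {n} {a : Vector ℤ (suc n)} {M : Matrix (2 ℕ.+ n) (2 ℕ.+ n)} (S : Staircase a M) where

  Staircase-submatrix : Staircase (a ∘ suc) (submatrix M suc (punchIn (suc zero)))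
  Staircase-submatrix = record
    { first = first S ∘ suc
    ; below = λ i j j<i → below S (suc i) (suc j) (s≤s j<i)
    ; step  = step S ∘ suc
    }

  Staircase-proportional : ∀ i → M (suc i) (suc zero) ≡ a zero * M (suc i) zero
  Staircase-proportional i = begin
    M (suc i) (suc zero)      ≡⟨ below S (suc i) zero (s≤s z≤n) ⟩
    a zero                    ≡⟨ ℤ.*-identityʳ (a zero) ⟨
    a zero * 1ℤ               ≡⟨ cong (a zero *_) (first S (suc i)) ⟨
    a zero * M (suc i) zero   ∎

-- The factor split off is one whatever `a zero` is, because the first row falls short of
-- proportionality by exactly one.
det-staircase : ∀ {n} {a : Vector ℤ n} {M} → Staircase a M → det M ≡ 1ℤ
det-staircase {zero}  S = cong (λ x → 1ℤ * x * 1ℤ + 0ℤ) (first S zero)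
det-staircase {suc n} {a} {M} S = begin
  det M
    ≡⟨ det-proportionalColumns (a zero) M (Staircase-proportional S) ⟩
  (a zero * M zero zero - M zero (suc zero)) * det (submatrix M suc (punchIn (suc zero)))
    ≡⟨ cong₂ _*_ (cong₂ (λ x y → a zero * x - y) (first S zero) (step S zero))
                 (det-staircase (Staircase-submatrix S)) ⟩
  (a zero * 1ℤ - (a zero - 1ℤ)) * 1ℤ
    ≡⟨ cancel (a zero) ⟩
  1ℤ ∎
  where
  cancel : ∀ x → (x * + 1 - (x - + 1)) * + 1 ≡ + 1
  cancel = solve-∀

-- Linear independence

-- Below the first row the first two columns merge into one with coefficient `c₀ + c₁ * a₀`;
-- induction kills this sum and all later coefficients. The first row, with entry `a₀ - 1ℤ` instead
-- of `a₀`, then isolates `c₁`.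
independent-staircase : ∀ {n} {a : Vector ℤ n} {M} → Staircase a M →
  LinearlyIndependent (λ j i → M i j)
independent-staircase {zero} {M = M} S c Mc≡0 zero = begin
  c zero                          ≡⟨ ℤ.*-identityʳ (c zero) ⟨
  c zero * 1ℤ                     ≡⟨ cong (c zero *_) (first S zero) ⟨
  c zero * M zero zero            ≡⟨ ℤ.+-identityʳ _ ⟨
  c zero * M zero zero + 0ℤ       ≡⟨ Mc≡0 zero ⟩
  0ℤ                              ∎
independent-staircase {suc n} {a} {M} S c Mc≡0 = λ where
    zero          → c₀≡0
    (suc zero)    → c₁≡0
    (suc (suc j)) → c′≡0 (suc j)
  where
  c₀ = c zero
  c₁ = c (suc zero)
  a₀ = a zero

  c′ : Vector ℤ (suc n)
  c′ = (c₀ + c₁ * a₀) ∷ λ j → c (suc (suc j))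

  rest : Fin (2 ℕ.+ n) → ℤ
  rest i = ∑ λ j → c (suc (suc j)) * M i (suc (suc j))

  merge : ∀ c₀ c₁ a m r → (c₀ + c₁ * a) * m + r ≡ c₀ * m + (c₁ * (a * m) + r)
  merge = solve-∀

  c′≡0 : ∀ j → c′ j ≡ 0ℤ
  c′≡0 = independent-staircase (Staircase-submatrix S) c′ λ i → begin
    (c₀ + c₁ * a₀) * M (suc i) zero + rest (suc i)
      ≡⟨ merge c₀ c₁ a₀ (M (suc i) zero) (rest (suc i)) ⟩
    c₀ * M (suc i) zero + (c₁ * (a₀ * M (suc i) zero) + rest (suc i))
      ≡⟨ cong (λ x → c₀ * M (suc i) zero + (c₁ * x + rest (suc i))) (Staircase-proportional S i) ⟨
    c₀ * M (suc i) zero + (c₁ * M (suc i) (suc zero) + rest (suc i))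
      ≡⟨ Mc≡0 (suc i) ⟩
    0ℤ ∎

  rest≡0 : rest zero ≡ 0ℤ
  rest≡0 = ∑-zero λ j → cong (_* M zero (suc (suc j))) (c′≡0 (suc j))

  isolate : ∀ c₀ c₁ a → c₁ ≡ (c₀ + c₁ * a) - (c₀ * + 1 + (c₁ * (a - + 1) + + 0))
  isolate = solve-∀

  row₀ : c₀ * 1ℤ + (c₁ * (a₀ - 1ℤ) + 0ℤ) ≡ 0ℤ
  row₀ = begin
    c₀ * 1ℤ + (c₁ * (a₀ - 1ℤ) + 0ℤ)
      ≡⟨ cong₂ (λ x y → c₀ * x + y) (first S zero)
           (cong₂ (λ x y → c₁ * x + y) (step S zero) rest≡0) ⟨
    c₀ * M zero zero + (c₁ * M zero (suc zero) + rest zero)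
      ≡⟨ Mc≡0 zero ⟩
    0ℤ ∎

  c₁≡0 : c₁ ≡ 0ℤ
  c₁≡0 = begin
    c₁
      ≡⟨ isolate c₀ c₁ a₀ ⟩
    (c₀ + c₁ * a₀) - (c₀ * 1ℤ + (c₁ * (a₀ - 1ℤ) + 0ℤ))
      ≡⟨ cong₂ _-_ (c′≡0 zero) row₀ ⟩
    0ℤ ∎

  c₀≡0 : c₀ ≡ 0ℤ
  c₀≡0 = begin
    c₀            ≡⟨ ℤ.+-identityʳ c₀ ⟨
    c₀ + 0ℤ * a₀  ≡⟨ cong (λ x → c₀ + x * a₀) c₁≡0 ⟨
    c₀ + c₁ * a₀  ≡⟨ c′≡0 zero ⟩
    0ℤ            ∎

-- Gaussian elimination without division.
independent⇒≤ : ∀ {m k} (v : Vector (Vector ℤ m) k) → LinearlyIndependent v → k ≤ m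
independent⇒≤ {k = zero} v indep = z≤n
-- Without coordinates every relation holds, even the one with all coefficients one.
independent⇒≤ {zero} {suc k} v indep with () ← indep (λ _ → 1ℤ) (λ ()) zero
independent⇒≤ {suc m} {suc k} v indep with Fin.any? (λ j → ¬? (v j zero ℤ.≟ 0ℤ))
-- All first coordinates vanish, so the vectors stay independent without them.
... | no none = ℕ.m≤n⇒m≤1+n (independent⇒≤ (λ j i → v j (suc i)) λ c eq →
    indep c λ where
      zero    → ∑-zero λ j → trans
        (cong (c j *_) (decidable-stable (v j zero ℤ.≟ 0ℤ) λ vj≢0 → none (j , vj≢0)))
        (ℤ.*-zeroʳ (c j))
      (suc i) → eq i)
... | yes (p , x≢0) = s≤s (independent⇒≤ (λ j i → w j (suc i)) λ c eq j →
    cancel (trans (sym (insertAt-punchIn (λ j → x * c j) p (c̃ₚ c) j))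
                  (indep (c̃ c) (c̃-relation c eq) (punchIn p j))))
  where
  x = v p zero

  u : Fin k → Vector ℤ (suc m)
  u j = v (punchIn p j)

  w : Fin k → Vector ℤ (suc m)
  w j i = x * u j i - u j zero * v p i

  -- The pivot's coefficient when a relation among the `w j` is rewritten in terms of `v`. The other
  -- coefficients become `x * c j`, from which `x≢0` recovers `c j ≡ 0ℤ`.
  c̃ₚ : Vector ℤ k → ℤ
  c̃ₚ c = ∑ λ j → - (c j * u j zero)

  c̃ : Vector ℤ k → Vector ℤ (suc k)
  c̃ c = insertAt (λ j → x * c j) p (c̃ₚ c)

  cancel : ∀ {y} → x * y ≡ 0ℤ → y ≡ 0ℤ
  cancel xy≡0 = [ (λ x≡0 → contradiction x≡0 x≢0) , id ]′ (ℤ.i*j≡0⇒i≡0∨j≡0 x xy≡0)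

  combine : ∀ x c u₀ u v → - (c * u₀) * v + x * c * u ≡ c * (x * u - u₀ * v)
  combine = solve-∀

  reduce : ∀ c i → ∑ (λ j → c̃ c j * v j i) ≡ ∑ (λ j → c j * w j i)
  reduce c i = begin
    ∑ (λ j → c̃ c j * v j i)
      ≡⟨ Sum.sum-remove {i = p} (λ j → c̃ c j * v j i) ⟩
    c̃ c p * v p i + ∑ (λ j → c̃ c (punchIn p j) * u j i)
      ≡⟨ cong₂ (λ y z → y * v p i + z) (insertAt-lookup (λ j → x * c j) p (c̃ₚ c))
           (∑-cong λ j → cong (_* u j i) (insertAt-punchIn (λ j → x * c j) p (c̃ₚ c) j)) ⟩
    c̃ₚ c * v p i + ∑ (λ j → x * c j * u j i)
      ≡⟨ cong (_+ ∑ (λ j → x * c j * u j i)) (Sum.*-distribʳ-sum (v p i) (λ j → - (c j * u j zero))) ⟩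
    ∑ (λ j → - (c j * u j zero) * v p i) + ∑ (λ j → x * c j * u j i)
      ≡⟨ Sum.∑-distrib-+ (λ j → - (c j * u j zero) * v p i) (λ j → x * c j * u j i) ⟨
    ∑ (λ j → - (c j * u j zero) * v p i + x * c j * u j i)
      ≡⟨ ∑-cong (λ j → combine x (c j) (u j zero) (u j i) (v p i)) ⟩
    ∑ (λ j → c j * w j i) ∎

  c̃-relation : ∀ c → (∀ i → ∑ (λ j → c j * w j (suc i)) ≡ 0ℤ) → ∀ i → ∑ (λ j → c̃ c j * v j i) ≡ 0ℤ
  c̃-relation c eq zero = trans (reduce c zero) (∑-zero λ j → trans
    (cong (c j *_) (ℤ.i≡j⇒i-j≡0 (ℤ.*-comm x (u j zero)))) (ℤ.*-zeroʳ (c j)))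
  c̃-relation c eq (suc i) = trans (reduce c (suc i)) (eq i)

-- Minors

-- Built with the same operations as the first branch of `selections`, so that membership needs no
-- function extensionality.
initial : ∀ {k n} → k ≤ n → Vector (Fin n) k
initial z≤n       = []
initial (s≤s k≤n) = zero ∷ (suc ∘ initial k≤n)

toℕ-initial : ∀ {k n} (k≤n : k ≤ n) i → toℕ (initial k≤n i) ≡ toℕ i
toℕ-initial (s≤s k≤n) zero    = refl
toℕ-initial (s≤s k≤n) (suc i) = cong suc (toℕ-initial k≤n i)

initial∈selections : ∀ {k n} (k≤n : k ≤ n) → initial k≤n ∈ selections k n
initial∈selections z≤n       = here refl
initial∈selections (s≤s k≤n) =
  ∈-++⁺ˡ (∈-map⁺ (λ s → zero ∷ (suc ∘ s)) (initial∈selections k≤n))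

foldr-gcd-∣ : ∀ {xs : List ℤ} {x} → x ∈ xs → List.foldr gcd 0 (List.map ∣_∣ xs) ∣ ∣ x ∣
foldr-gcd-∣ {x List.∷ xs} (here refl) = gcd[m,n]∣m ∣ x ∣ _
foldr-gcd-∣ {x List.∷ xs} (there y∈xs) = ∣-trans (gcd[m,n]∣n ∣ x ∣ _) (foldr-gcd-∣ y∈xs)

-- The gcd divides every listed minor, so a single minor equal to one decides it.
D≡1 : ∀ {m n k} (M : Matrix m n) {rows : Vector (Fin m) k} {cols : Vector (Fin n) k} →
  rows ∈ selections k m → cols ∈ selections k n →
  det (submatrix M rows cols) ≡ 1ℤ → D M k ≡ 1
D≡1 {k = k} M rows∈ cols∈ det≡1 = ∣1⇒≡1 (subst (λ d → D M k ∣ ∣ d ∣) det≡1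
  (foldr-gcd-∣ (∈-cartesianProductWith⁺ (λ rows cols → det (submatrix M rows cols)) rows∈ cols∈)))

IsQuotient-1 : ∀ {a b} → a ≡ 1 → b ≡ 1 → IsQuotient a b 1
IsQuotient-1 refl refl = _ , refl

-- Walks

walks : ∀ {n} → Matrix n n → ℕ → Vector ℤ n
walks {n} A k = power A k ⊛ replicate n 1ℤ

⊛-identityˡ : ∀ {n} (v : Vector ℤ n) i → (identity ⊛ v) i ≡ v i
⊛-identityˡ {suc n} v zero = trans
  (cong₂ _+_ (ℤ.*-identityˡ (v zero)) (Sum.sum-replicate-zero n)) (ℤ.+-identityʳ (v zero))
⊛-identityˡ v (suc i) = trans (ℤ.+-identityˡ _) (⊛-identityˡ (v ∘ suc) i)

⊛-assoc : ∀ {l m n} (A : Matrix l m) (B : Matrix m n) v i → ((A ⊗ B) ⊛ v) i ≡ (A ⊛ (B ⊛ v)) i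
⊛-assoc A B v i = begin
  ∑ (λ k → ∑ (λ j → A i j * B j k) * v k)
    ≡⟨ ∑-cong (λ k → Sum.*-distribʳ-sum (v k) (λ j → A i j * B j k)) ⟩
  ∑ (λ k → ∑ λ j → A i j * B j k * v k)
    ≡⟨ Sum.∑-comm (λ k j → A i j * B j k * v k) ⟩
  ∑ (λ j → ∑ λ k → A i j * B j k * v k)
    ≡⟨ ∑-cong (λ j → ∑-cong λ k → ℤ.*-assoc (A i j) (B j k) (v k)) ⟩
  ∑ (λ j → ∑ λ k → A i j * (B j k * v k))
    ≡⟨ ∑-cong (λ j → Sum.*-distribˡ-sum (A i j) (λ k → B j k * v k)) ⟨
  ∑ (λ j → A i j * ∑ λ k → B j k * v k) ∎

walks-zero : ∀ {n} (A : Matrix n n) i → walks A 0 i ≡ 1ℤ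
walks-zero {n} A = ⊛-identityˡ (replicate n 1ℤ)

walks-suc : ∀ {n} (A : Matrix n n) k i → walks A (suc k) i ≡ (A ⊛ walks A k) i
walks-suc {n} A k = ⊛-assoc A (power A k) (replicate n 1ℤ)

path : ∀ n → Matrix n n
path n = adjacencyMatrix (dynkinA n)

path-end : ∀ {n} (v : Vector ℤ (2 ℕ.+ n)) → (path (2 ℕ.+ n) ⊛ v) zero ≡ v (suc zero)
path-end {n} v = begin
  0ℤ + (1ℤ * v (suc zero) + ∑ (λ j → 0ℤ * v (suc (suc j))))
    ≡⟨ ℤ.+-identityˡ _ ⟩
  1ℤ * v (suc zero) + ∑ (λ j → 0ℤ * v (suc (suc j)))
    ≡⟨ cong₂ _+_ (ℤ.*-identityˡ (v (suc zero))) (Sum.sum-replicate-zero n) ⟩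
  v (suc zero) + 0ℤ
    ≡⟨ ℤ.+-identityʳ _ ⟩
  v (suc zero) ∎

-- Adjacency depends only on the difference of indices, so leading vertices can be stripped until
-- `a` is the first vertex; `path-end` then supplies the right neighbour.
path-interior : ∀ {n} (v : Vector ℤ n) a i b → toℕ i ≡ suc (toℕ a) → toℕ b ≡ suc (toℕ i) →
  (path n ⊛ v) i ≡ v a + v b
path-interior v zero (suc zero) (suc (suc zero)) _ _ =
  cong₂ _+_ (ℤ.*-identityˡ (v zero)) (path-end (v ∘ suc))
path-interior v (suc a) (suc i@(suc _)) (suc b) i≡1+a b≡1+i = trans (ℤ.+-identityˡ _)
  (path-interior (v ∘ suc) a i b (ℕ.suc-injective i≡1+a) (ℕ.suc-injective b≡1+i))

-- The bounds keep walks of length `k` from passing either end, so each step has two choices; both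
-- neighbours satisfy the bounds for one step fewer.
walks-far : ∀ {n} k (i : Fin n) → k ≤ toℕ i → toℕ i ℕ.+ k < n → walks (path n) k i ≡ (+ 2) ℤ.^ k
walks-far zero i _ _ = walks-zero (path _) i
walks-far {n} (suc k) i@(suc i′) (s≤s k≤i′) i+1+k<n = begin
  walks (path n) (suc k) i
    ≡⟨ walks-suc (path n) k i ⟩
  (path n ⊛ walks (path n) k) i
    ≡⟨ path-interior (walks (path n) k) (inject₁ i′) i (fromℕ< 1+i<n)
         (cong suc (sym (Fin.toℕ-inject₁ i′))) (Fin.toℕ-fromℕ< 1+i<n) ⟩
  walks (path n) k (inject₁ i′) + walks (path n) k (fromℕ< 1+i<n)
    ≡⟨ cong₂ _+_ left right ⟩
  (+ 2) ℤ.^ k + (+ 2) ℤ.^ k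
    ≡⟨ double ((+ 2) ℤ.^ k) ⟩
  (+ 2) ℤ.^ suc k ∎
  where
  double : ∀ x → x + x ≡ (+ 2) * x
  double = solve-∀

  1+i+k<n : suc (toℕ i) ℕ.+ k < n
  1+i+k<n = subst (_< n) (ℕ.+-suc (toℕ i) k) i+1+k<n

  1+i<n : suc (toℕ i) < n
  1+i<n = ℕ.≤-<-trans (ℕ.m≤m+n (suc (toℕ i)) k) 1+i+k<n

  left : walks (path n) k (inject₁ i′) ≡ (+ 2) ℤ.^ k
  left = walks-far k (inject₁ i′)
    (subst (k ≤_) (sym (Fin.toℕ-inject₁ i′)) k≤i′)
    (subst (λ x → x ℕ.+ k < n) (sym (Fin.toℕ-inject₁ i′)) (ℕ.<-trans (ℕ.n<1+n _) (ℕ.<-trans (ℕ.n<1+n _) 1+i+k<n)))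

  right : walks (path n) k (fromℕ< 1+i<n) ≡ (+ 2) ℤ.^ k
  right = walks-far k (fromℕ< 1+i<n)
    (subst (k ≤_) (sym (Fin.toℕ-fromℕ< 1+i<n)) (ℕ.m≤n⇒m≤1+n (ℕ.m≤n⇒m≤1+n k≤i′)))
    (subst (λ x → x ℕ.+ k < n) (sym (Fin.toℕ-fromℕ< 1+i<n)) 1+i+k<n)

-- Of the unrestricted walks only the one that always steps left leaves the path. The left neighbour
-- is again in this case, the right one in that of `walks-far`.
walks-near : ∀ {n} k (i : Fin n) → toℕ i ≡ k → suc (k ℕ.+ k) < n →
  walks (path n) (suc k) i ≡ (+ 2) ℤ.^ suc k - 1ℤ
walks-near zero zero _ (s≤s (s≤s {n = n} _)) = begin
  walks A 1 zero            ≡⟨ walks-suc A 0 zero ⟩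
  (A ⊛ walks A 0) zero      ≡⟨ path-end (walks A 0) ⟩
  walks A 0 (suc zero)      ≡⟨ walks-zero A (suc zero) ⟩
  1ℤ                        ∎
  where A = path (2 ℕ.+ n)
walks-near {n} k@(suc k′) i@(suc i′) i≡k 1+k+k<n = begin
  walks (path n) (suc k) i
    ≡⟨ walks-suc (path n) k i ⟩
  (path n ⊛ walks (path n) k) i
    ≡⟨ path-interior (walks (path n) k) (inject₁ i′) i (fromℕ< 1+k<n)
         (cong suc (sym (Fin.toℕ-inject₁ i′))) (trans b≡1+k (cong suc (sym i≡k))) ⟩
  walks (path n) k (inject₁ i′) + walks (path n) k (fromℕ< 1+k<n)
    ≡⟨ cong₂ _+_ left right ⟩
  ((+ 2) ℤ.^ k - 1ℤ) + (+ 2) ℤ.^ k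
    ≡⟨ double ((+ 2) ℤ.^ k) 1ℤ ⟩
  (+ 2) ℤ.^ suc k - 1ℤ ∎
  where
  double : ∀ x y → (x - y) + x ≡ (+ 2) * x - y
  double = solve-∀

  1+k<n : suc k < n
  1+k<n = ℕ.≤-<-trans (ℕ.m≤m+n (suc k) k) 1+k+k<n

  b≡1+k : toℕ (fromℕ< 1+k<n) ≡ suc k
  b≡1+k = Fin.toℕ-fromℕ< 1+k<n

  left : walks (path n) k (inject₁ i′) ≡ (+ 2) ℤ.^ k - 1ℤ
  left = walks-near k′ (inject₁ i′) (trans (Fin.toℕ-inject₁ i′) (ℕ.suc-injective i≡k))
    (ℕ.≤-<-trans (s≤s (ℕ.+-mono-≤ (ℕ.n≤1+n k′) (ℕ.n≤1+n k′))) 1+k+k<n)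

  right : walks (path n) k (fromℕ< 1+k<n) ≡ (+ 2) ℤ.^ k
  right = walks-far k (fromℕ< 1+k<n)
    (subst (k ≤_) (sym b≡1+k) (ℕ.n≤1+n k))
    (subst (λ x → x ℕ.+ k < n) (sym b≡1+k) 1+k+k<n)

-- Reflection symmetry of the path

∣o∸m-o∸n∣≡∣m-n∣ : ∀ {m n o} → m ≤ o → n ≤ o → ℕ.∣ o ∸ m - o ∸ n ∣ ≡ ℕ.∣ m - n ∣
∣o∸m-o∸n∣≡∣m-n∣ {n = n} {o} z≤n n≤o =
  trans (ℕ.m≤n⇒∣n-m∣≡n∸m (ℕ.m∸n≤m o n)) (ℕ.m∸[m∸n]≡n n≤o)
∣o∸m-o∸n∣≡∣m-n∣ {m@(suc _)} {o = o} m≤o z≤n =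
  trans (ℕ.m≤n⇒∣m-n∣≡n∸m (ℕ.m∸n≤m o m)) (ℕ.m∸[m∸n]≡n m≤o)
∣o∸m-o∸n∣≡∣m-n∣ (s≤s m≤o) (s≤s n≤o) = ∣o∸m-o∸n∣≡∣m-n∣ m≤o n≤o

path-opposite : ∀ {n} (i j : Fin n) → path n (opposite i) (opposite j) ≡ path n i j
path-opposite {n} i j = cong (λ d → if does (d ℕ.≟ 1) then 1ℤ else 0ℤ) (begin
  ℕ.∣ toℕ (opposite i) - toℕ (opposite j) ∣ ≡⟨ cong₂ ℕ.∣_-_∣ (Fin.opposite-prop i) (Fin.opposite-prop j) ⟩
  ℕ.∣ n ∸ suc (toℕ i) - n ∸ suc (toℕ j) ∣   ≡⟨ ∣o∸m-o∸n∣≡∣m-n∣ (Fin.toℕ<n i) (Fin.toℕ<n j) ⟩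
  ℕ.∣ toℕ i - toℕ j ∣                       ∎)

-- Reflection is an automorphism of the path, so the sum over neighbours can be reindexed along it.
walks-opposite : ∀ {n} k (i : Fin n) → walks (path n) k (opposite i) ≡ walks (path n) k i
walks-opposite {n} zero i = trans (walks-zero (path n) (opposite i)) (sym (walks-zero (path n) i))
walks-opposite {n} (suc k) i = begin
  walks (path n) (suc k) (opposite i)
    ≡⟨ walks-suc (path n) k (opposite i) ⟩
  ∑ (λ j → path n (opposite i) j * walks (path n) k j)
    ≡⟨ Sum.sum-permute (λ j → path n (opposite i) j * walks (path n) k j) Perm.reverse ⟩
  ∑ (λ j → path n (opposite i) (opposite j) * walks (path n) k (opposite j))
    ≡⟨ ∑-cong (λ j → cong₂ _*_ (path-opposite i j) (walks-opposite k j)) ⟩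
  ∑ (λ j → path n i j * walks (path n) k j)
    ≡⟨ walks-suc (path n) k i ⟨
  walks (path n) (suc k) i ∎

-- Smith normal form

n≤⌈n/2⌉+⌈n/2⌉ : ∀ n → n ≤ ⌈ n /2⌉ ℕ.+ ⌈ n /2⌉
n≤⌈n/2⌉+⌈n/2⌉ n = subst (_≤ ⌈ n /2⌉ ℕ.+ ⌈ n /2⌉) (ℕ.⌊n/2⌋+⌈n/2⌉≡n n)
  (ℕ.+-monoˡ-≤ ⌈ n /2⌉ (ℕ.⌊n/2⌋≤⌈n/2⌉ n))

k<⌈n/2⌉⇒k+k<n : ∀ {k n} → k < ⌈ n /2⌉ → k ℕ.+ k < n
-- Since `⌈ n /2⌉` is the floor of half of `suc n`, adding floor and ceiling for `suc n` gives 2k +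
-- 2 ≤ n + 1.
k<⌈n/2⌉⇒k+k<n {k} {n} k<⌈n/2⌉ = subst (_≤ n) (ℕ.+-suc k k) (ℕ.≤-pred (ℕ.≤-trans
  (ℕ.+-mono-≤ k<⌈n/2⌉ (ℕ.≤-trans k<⌈n/2⌉ (ℕ.⌊n/2⌋≤⌈n/2⌉ (suc n))))
  (ℕ.≤-reflexive (ℕ.⌊n/2⌋+⌈n/2⌉≡n (suc n)))))

module _ (n : ℕ) where

  W : Matrix n n
  W = walkMatrix (dynkinA n)

  leading : ∀ {k} → k ≤ n → Matrix k k
  leading k≤n = submatrix W (initial k≤n) (initial k≤n)

  leading≡walks : ∀ {k} (k≤n : k ≤ n) i j → leading k≤n i j ≡ walks (path n) (toℕ j) (initial k≤n i)
  leading≡walks k≤n i j = cong (λ t → walks (path n) t (initial k≤n i)) (toℕ-initial k≤n j)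

  -- Column `suc j` counts walks of length j + 1. By `k+k<n` those from the constrained rows never
  -- pass the right end; the left end is safe when j < i and is passed by one walk when i = j.
  leading-staircase : ∀ {k} (k<n : suc k ≤ n) → suc k ≤ ⌈ n /2⌉ →
    Staircase (λ j → (+ 2) ℤ.^ suc (toℕ j)) (leading k<n)
  leading-staircase {k} k<n k<⌈n/2⌉ = record
    { first = λ i → trans (leading≡walks k<n i zero) (walks-zero (path n) (row i))
    ; below = λ i j j<i → trans (leading≡walks k<n i (suc j))
        (walks-far (suc (toℕ j)) (row i)
          (subst (toℕ j <_) (sym (toℕ-initial k<n i)) j<i)
          (subst (λ t → t ℕ.+ suc (toℕ j) < n) (sym (toℕ-initial k<n i))
            (ℕ.≤-<-trans (ℕ.+-mono-≤ (i≤k i) (ℕ.≤-trans j<i (i≤k i))) k+k<n)))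
    ; step = λ j → trans (leading≡walks k<n (inject₁ j) (suc j))
        (walks-near (toℕ j) (row (inject₁ j)) (trans (toℕ-initial k<n (inject₁ j)) (Fin.toℕ-inject₁ j))
          (ℕ.≤-<-trans (ℕ.+-mono-≤ (Fin.toℕ<n j) (Fin.toℕ≤n j)) k+k<n))
    }
    where
    row : Fin (suc k) → Fin n
    row = initial k<n

    i≤k : ∀ (i : Fin (suc k)) → toℕ i ≤ k
    i≤k = Fin.toℕ≤pred[n]

    k+k<n : k ℕ.+ k < n
    k+k<n = k<⌈n/2⌉⇒k+k<n k<⌈n/2⌉

  det-leading : ∀ {k} (k≤n : k ≤ n) → k ≤ ⌈ n /2⌉ → det (leading k≤n) ≡ 1ℤ
  det-leading {zero}  k≤n k≤⌈n/2⌉ = refl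
  det-leading {suc k} k≤n k≤⌈n/2⌉ = det-staircase (leading-staircase k≤n k≤⌈n/2⌉)

  D-walkMatrix : ∀ {k} → k ≤ ⌈ n /2⌉ → D W k ≡ 1
  D-walkMatrix k≤⌈n/2⌉ =
    D≡1 W (initial∈selections k≤n) (initial∈selections k≤n) (det-leading k≤n k≤⌈n/2⌉)
    where k≤n = ℕ.≤-trans k≤⌈n/2⌉ (ℕ.⌈n/2⌉≤n n)

  independent-leading : ∀ {k} (k≤n : k ≤ n) → k ≤ ⌈ n /2⌉ →
    LinearlyIndependent (columns W (initial k≤n))
  independent-leading {zero}  k≤n k≤⌈n/2⌉ c eq ()
  independent-leading {suc k} k≤n k≤⌈n/2⌉ c eq =
    independent-staircase (leading-staircase k≤n k≤⌈n/2⌉) c (λ i → eq (initial k≤n i))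

  HasRank-walkMatrix : HasRank W ⌈ n /2⌉
  HasRank-walkMatrix = (initial r≤n , independent-leading r≤n ℕ.≤-refl) , λ k cols indep →
    -- Columns are cut down to their first `r` rows. This preserves independence, since a relation
    -- on those rows extends to the mirrored ones.
    independent⇒≤ (λ j i → W (initial r≤n i) (cols j)) λ c eq → indep c λ i →
      upper-half⇒all c cols (λ i i<r → subst (Vanishes c cols) (initial-fromℕ< i i<r) (eq (fromℕ< i<r))) i
    where
    r = ⌈ n /2⌉

    r≤n : r ≤ n
    r≤n = ℕ.⌈n/2⌉≤n n

    Vanishes : ∀ {k} → Vector ℤ k → Vector (Fin n) k → Fin n → Set
    Vanishes c cols i = ∑ (λ j → c j * W i (cols j)) ≡ 0ℤ

    initial-fromℕ< : ∀ i (i<r : toℕ i < r) → initial r≤n (fromℕ< i<r) ≡ i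
    initial-fromℕ< i i<r =
      Fin.toℕ-injective (trans (toℕ-initial r≤n (fromℕ< i<r)) (Fin.toℕ-fromℕ< i<r))

    opposite<r : ∀ i → r ≤ toℕ i → toℕ (opposite i) < r
    opposite<r i r≤i = subst (_< r) (sym (Fin.opposite-prop i)) (ℕ.m<n+o⇒m∸n<o n (suc (toℕ i))
      -- Truncated subtraction gives a strict bound only for positive `r`; here `r` equal to zero
      -- would force `n` to be zero, yet `i` is a vertex.
      {{ℕ.>-nonZero (ℕ.n≢0⇒n>0 r≢0)}}
      (s≤s (ℕ.≤-trans (n≤⌈n/2⌉+⌈n/2⌉ n) (ℕ.+-monoˡ-≤ r r≤i))))
      where
      r≢0 : ¬ r ≡ 0
      r≢0 r≡0 = ℕ.n≮0 (ℕ.<-≤-trans (Fin.toℕ<n i)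
        (subst (λ t → n ≤ t ℕ.+ t) r≡0 (n≤⌈n/2⌉+⌈n/2⌉ n)))

    upper-half⇒all : ∀ {k} (c : Vector ℤ k) cols →
      (∀ i → toℕ i < r → Vanishes c cols i) → ∀ i → Vanishes c cols i
    upper-half⇒all c cols upper i with ℕ.<-≤-connex (toℕ i) r
    ... | inj₁ i<r = upper i i<r
    ... | inj₂ r≤i = trans
      (∑-cong λ j → cong (c j *_) (sym (walks-opposite (toℕ (cols j)) i)))
      (upper (opposite i) (opposite<r i r≤i))

theorem3p1 : (n : ℕ) .{{_ : NonZero n}} →
    IsSmithNormalForm (walkMatrix (dynkinA n)) (diag ⌈ n /2⌉ (λ _ → 1))
theorem3p1 n = ⌈ n /2⌉ , (λ _ → 1) , HasRank-walkMatrix n ,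
  (λ k _ k≤r → IsQuotient-1 (D-walkMatrix n k≤r)
                            (D-walkMatrix n (ℕ.≤-trans (ℕ.m∸n≤m k 1) k≤r))) ,
  λ _ _ → refl
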